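{- There is a constant $c$ such that if $q>cp^2$, then for every $n$ sufficiently large, the $(p,q)$-biased Clique game on $K_n$ is won by player $2$.
   Context: Two players, Alice (player 1, starting) and Bob (player 2), alternately colour uncoloured edges of the complete graph $K_n$, Alice in red and Bob in blue; in the $(p,q)$-biased version Alice colours $p$ edges per turn and Bob $q$ edges per turn. In the Clique game, Alice's score is $a=\omega(G[A])$ and Bob's is $b=\omega(G[B])$, the clique numbers of the red and blue graphs. When $q>p$, Bob (player 2) wins if at the end $b>a$. -}

module Defs where

open import Data.Nat using (ℕ; zero; suc; _*_; _<_; _≤_)
open import Data.Fin using (Fin) renaming (_<_ to _<ᶠ_)
open import Data.Fin.Properties using (_≟_)
open import Data.Fin.Subset using (Subset; _∈_; ∣_∣)
open import Data.Bool using (if_then_else_)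
open import Data.Product using (Σ; _×_; ∃)
open import Relation.Binary.PropositionalEquality using (_≡_; _≢_)
open import Relation.Nullary using (¬_)
open import Relation.Nullary.Decidable using (⌊_⌋; _×-dec_)

data Colour : Set where
  unc red blue : Colour

-- A (partial) edge colouring of K_n. The edge {i,j} with i < j is
-- represented by the entry (i , j); entries with ¬ (i < j) are ignored.
Colouring : ℕ → Set
Colouring n = Fin n → Fin n → Colour

empty : ∀ {n} → Colouring n
empty _ _ = unc

update : ∀ {n} → Colouring n → Fin n → Fin n → Colour → Colouring n
update col i j c i' j' =
  if ⌊ (i' ≟ i) ×-dec (j' ≟ j) ⌋ then c else col i' j'

Full : ∀ {n} → Colouring n → Set
Full {n} col = (i j : Fin n) → i <ᶠ j → col i j ≢ unc

IsClique : ∀ {n} → Colouring n → Colour → Subset n → Set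
IsClique col c S = ∀ i j → i ∈ S → j ∈ S → i <ᶠ j → col i j ≡ c

CliqueNumber : ∀ {n} → Colouring n → Colour → ℕ → Set
CliqueNumber col c k =
  (Σ _ λ S → ∣ S ∣ ≡ k × IsClique col c S) ×
  (∀ S → IsClique col c S → ∣ S ∣ ≤ k)

data Player : Set where
  alice bob : Player

-- BobWins p q pl k col : in the (p,q)-biased Clique game, in position col,
-- with player pl to move and k single-edge moves left in pl's current turn,
-- Bob (player 2) has a winning strategy. A turn of p (resp. q) edges is
-- played as p (resp. q) consecutive single-edge moves by the same player;
-- the game ends as soon as all edges are coloured (so a last turn may be
-- shorter). Bob wins iff at the end b = ω(blue) > a = ω(red).
data BobWins {n : ℕ} (p q : ℕ) : Player → ℕ → Colouring n → Set where
  over      : ∀ {pl k col} → Full col →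
              (∀ a b → CliqueNumber col red a → CliqueNumber col blue b → a < b) →
              BobWins p q pl k col
  passA     : ∀ {col} → ¬ Full col → BobWins p q bob q col →
              BobWins p q alice zero col
  passB     : ∀ {col} → ¬ Full col → BobWins p q alice p col →
              BobWins p q bob zero col
  aliceMove : ∀ {k col} → ¬ Full col →
              (∀ i j → i <ᶠ j → col i j ≡ unc →
                 BobWins p q alice k (update col i j red)) →
              BobWins p q alice (suc k) col
  bobMove   : ∀ {k col} (i j : Fin n) → i <ᶠ j → col i j ≡ unc →
              BobWins p q bob k (update col i j blue) →
              BobWins p q bob (suc k) col

Player2Wins : ℕ → ℕ → ℕ → Set
Player2Wins p q n = BobWins {n} p q alice p empty

{-# OPTIONS --safe #-}
module Submission where

-- Bob plays greedily against a potential. Give a red edge weight 1 + 1/(2p), a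
-- blue edge 1 − 1/β with β = 800p² ≤ q, and let Φ be the sum over all vertex
-- sets S of (2n)^(-|S|) times the product of the weights of the edges inside S.
-- If Bob always takes the edge in which Φ is steepest, one turn of q blue edges
-- pays for the next turn of p red edges, so Φ at most doubles during the game.
-- A single term of the final Φ, raised to the power β/2, then says that every S
-- satisfies
--   200p · red(S) ≤ blue(S) + O(p² |S| log n).
-- A red clique has blue(S) = 0, hence O(p log n) vertices. Every S with at least
-- order p² log n vertices has a vertex of red degree at most |S|/(100p), and
-- moving repeatedly to the blue neighbourhood of such a vertex loses a fraction
-- 1/(50p) per step, which yields a larger blue clique.

open import Defs
open import Data.Nat using (ℕ; zero; suc; _+_; _*_; _^_; _<_; _≤_; z≤n; s≤s; pred; NonZero; >-nonZero; >-nonZero⁻¹)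
open import Data.Nat.Properties
  hiding (_≟_; _<?_; suc-injective)
open import Data.Nat.Tactic.RingSolver using (solve-∀)
open import Data.Fin using (Fin; zero; suc) renaming (_<_ to _<ᶠ_)
open import Data.Fin.Properties as Finₚ using (_≟_; _<?_; suc-injective; any?)
open import Data.Fin.Subset using (Subset; ∣_∣; ∁; inside; outside; _∈_; _∉_; _∪_; ⁅_⁆; ⊤; ⊥; _⊆_)
open import Data.Fin.Subset.Properties
  using (_∈?_; ∪-identityʳ; x∈p∪q⁻; x∈⁅y⁆⇒x≡y; ∉⊥; ∣⊥∣≡0; ∣⊤∣≡n)
open import Data.Vec using ([]; _∷_; lookup; here; there; tabulate)
open import Data.Vec.Properties using ([]=⇒lookup; lookup⇒[]=; lookup∘tabulate)
open import Data.Bool using (Bool; true; false; _∧_; if_then_else_)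
open import Data.List using (List; []; _∷_; filter; cartesianProduct; allFin)
open import Data.List.Extrema ≤-totalOrder using (argmax; argmax-all; f[xs]≤f[argmax])
open import Data.List.Membership.Propositional using () renaming (_∈_ to _∈ˡ_)
open import Data.List.Membership.Propositional.Properties
  using (∈-filter⁺; ∈-cartesianProduct⁺; ∈-allFin)
open import Data.List.Relation.Unary.All as All using (All)
open import Data.List.Relation.Unary.All.Properties using (all-filter)
open import Data.Product using (∃; ∃₂; uncurry; _×_; _,_; proj₁; proj₂)
open import Data.Sum using (_⊎_; inj₁; inj₂)
open import Function using (_∘_; case_of_)
open import Relation.Binary.PropositionalEquality
open import Relation.Nullary using (¬_; Dec; does; yes; no; contradiction)
open import Relation.Nullary.Decidable using (⌊_⌋; _×-dec_)
open import Algebra.Properties.CommutativeSemigroup *-commutativeSemigroup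
  using (x∙yz≈y∙xz; x∙yz≈yx∙z; xy∙z≈y∙xz) renaming (interchange to *-interchange)
open import Algebra.Properties.CommutativeSemigroup +-commutativeSemigroup
  using () renaming (interchange to +-interchange)
open import Algebra.Properties.Semiring.Sum +-*-semiring
  using (sum; sum-replicate-zero; sum-cong-≗; ∑-distrib-+; ∑-comm; *-distribˡ-sum; *-distribʳ-sum)
open import Algebra.Properties.CommutativeMonoid.Sum *-1-commutativeMonoid
  using () renaming (sum to prod; sum-cong-≗ to prod-cong)

open ≤-Reasoning

-- Finite sums and products.

sum-mono : ∀ {n} {f g : Fin n → ℕ} → (∀ i → f i ≤ g i) → sum f ≤ sum g
sum-mono {zero}  f≤g = z≤n
sum-mono {suc n} f≤g = +-mono-≤ (f≤g zero) (sum-mono (f≤g ∘ suc))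

sum-mono-< : ∀ {n} {f g : Fin n → ℕ} (k : Fin n) →
             (∀ i → f i ≤ g i) → f k < g k → sum f < sum g
sum-mono-< zero    f≤g fk<gk = +-mono-<-≤ fk<gk (sum-mono (f≤g ∘ suc))
sum-mono-< (suc k) f≤g fk<gk = +-mono-≤-< (f≤g zero) (sum-mono-< k (f≤g ∘ suc) fk<gk)

prod-mono : ∀ {n} {f g : Fin n → ℕ} → (∀ i → f i ≤ g i) → prod f ≤ prod g
prod-mono {zero}  f≤g = ≤-refl
prod-mono {suc n} f≤g = *-mono-≤ (f≤g zero) (prod-mono (f≤g ∘ suc))

prod-const : ∀ n c → prod {n} (λ _ → c) ≡ c ^ n
prod-const zero    c = refl
prod-const (suc n) c = cong (c *_) (prod-const n c)

-- The ratio of the changed factor is kept as a cross-multiplied pair `a`, `b`, which avoids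
-- division in ℕ; the other factors are compared pointwise.
prod-factor-≤ : ∀ {n} {f g : Fin n → ℕ} (k : Fin n) (a b : ℕ) →
                (∀ i → i ≢ k → f i ≤ g i) → a * f k ≤ b * g k →
                a * prod f ≤ b * prod g
prod-factor-≤ {suc n} {f} {g} zero a b f≤g le = begin
  a * (f zero * prod (f ∘ suc))  ≡⟨ *-assoc a (f zero) _ ⟨
  a * f zero * prod (f ∘ suc)    ≤⟨ *-mono-≤ le (prod-mono (λ i → f≤g (suc i) λ ())) ⟩
  b * g zero * prod (g ∘ suc)    ≡⟨ *-assoc b (g zero) _ ⟩
  b * (g zero * prod (g ∘ suc))  ∎
prod-factor-≤ {suc n} {f} {g} (suc k) a b f≤g le = begin
  a * (f zero * prod (f ∘ suc))  ≡⟨ x∙yz≈y∙xz a (f zero) _ ⟩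
  f zero * (a * prod (f ∘ suc))  ≤⟨ *-mono-≤ (f≤g zero λ ()) (prod-factor-≤ k a b (λ i i≢k → f≤g (suc i) (i≢k ∘ suc-injective)) le) ⟩
  g zero * (b * prod (g ∘ suc))  ≡⟨ x∙yz≈y∙xz (g zero) b _ ⟩
  b * (g zero * prod (g ∘ suc))  ∎

prod₂ : ∀ {n} → (Fin n → Fin n → ℕ) → ℕ
prod₂ G = prod λ i → prod (G i)

prod₂-factor-≤ : ∀ {n} {G H : Fin n → Fin n → ℕ} (k l : Fin n) (a b : ℕ) →
                 (∀ i j → ¬ (i ≡ k × j ≡ l) → G i j ≤ H i j) →
                 a * G k l ≤ b * H k l → a * prod₂ G ≤ b * prod₂ H
prod₂-factor-≤ k l a b G≤H le = prod-factor-≤ k a b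
  (λ i i≢k → prod-mono λ j → G≤H i j (i≢k ∘ proj₁))
  (prod-factor-≤ l a b (λ j j≢l → G≤H k j (j≢l ∘ proj₂)) le)

prod₂-factor : ∀ {n} {G H : Fin n → Fin n → ℕ} (k l : Fin n) (a b : ℕ) →
               (∀ i j → ¬ (i ≡ k × j ≡ l) → G i j ≡ H i j) →
               a * G k l ≡ b * H k l → a * prod₂ G ≡ b * prod₂ H
prod₂-factor k l a b G≗H eq = ≤-antisym
  (prod₂-factor-≤ k l a b (λ i j ne → ≤-reflexive (G≗H i j ne)) (≤-reflexive eq))
  (prod₂-factor-≤ k l b a (λ i j ne → ≤-reflexive (sym (G≗H i j ne))) (≤-reflexive (sym eq)))

sum₂ : ∀ {n} → (Fin n → Fin n → ℕ) → ℕ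
sum₂ G = sum λ i → sum (G i)

-- Powers and Bernoulli inequalities.

^-distribʳ-* : ∀ k a b → (a * b) ^ k ≡ a ^ k * b ^ k
^-distribʳ-* zero    a b = refl
^-distribʳ-* (suc k) a b = trans (cong (a * b *_) (^-distribʳ-* k a b))
  (*-interchange a b (a ^ k) (b ^ k))

^-cancelˡ-≤ : ∀ b {x y} → 1 < b → b ^ x ≤ b ^ y → x ≤ y
^-cancelˡ-≤ b 1<b le = ≮⇒≥ λ y<x → <⇒≱ (^-monoʳ-< b 1<b y<x) le

-- Bernoulli's inequality (1 + y/x)^k ≥ 1 + k·y/x with denominators cleared. The inductive step
-- discards the quadratic term k·y².
bernoulli-+ : ∀ k x y → x ^ k * (x + k * y) ≤ x * (x + y) ^ k
bernoulli-+ zero    x y = ≤-reflexive (trans (*-identityˡ (x + 0)) (trans (+-identityʳ x) (sym (*-identityʳ x))))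
bernoulli-+ (suc k) x y = begin
  x * x ^ k * (x + suc k * y)                    ≤⟨ m≤m+n _ (x ^ k * (k * y * y)) ⟩
  x * x ^ k * (x + suc k * y) + x ^ k * (k * y * y) ≡⟨ factorise x y k (x ^ k) ⟩
  (x + y) * (x ^ k * (x + k * y))                ≤⟨ *-monoʳ-≤ (x + y) (bernoulli-+ k x y) ⟩
  (x + y) * (x * (x + y) ^ k)                    ≡⟨ x∙yz≈y∙xz (x + y) x _ ⟩
  x * ((x + y) * (x + y) ^ k)                    ∎
  where
  factorise : ∀ x y k z → x * z * (x + suc k * y) + z * (k * y * y) ≡ (x + y) * (z * (x + k * y))
  factorise = solve-∀

-- Bernoulli's inequality for a negative increment: (1 - 1/(x+1))^k ≥ 1 - k/(x+1), where `r` is the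
-- numerator x + 1 - k.
bernoulli-pred : ∀ k r {x} → suc x ≡ k + r → suc x ^ k * r ≤ x ^ k * suc x
bernoulli-pred zero    r {x} refl = ≤-refl
bernoulli-pred (suc k) r {x} refl = begin
  suc x * suc x ^ k * r      ≡⟨ xy∙z≈y∙xz (suc x) (suc x ^ k) r ⟩
  suc x ^ k * (suc x * r)    ≤⟨ *-monoʳ-≤ (suc x ^ k) step ⟩
  suc x ^ k * (x * suc r)    ≡⟨ x∙yz≈y∙xz (suc x ^ k) x _ ⟩
  x * (suc x ^ k * suc r)    ≤⟨ *-monoʳ-≤ x (bernoulli-pred k (suc r) (sym (+-suc k r))) ⟩
  x * (x ^ k * suc x)        ≡⟨ *-assoc x (x ^ k) _ ⟨
  x * x ^ k * suc x          ∎
  where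
  step : suc x * r ≤ x * suc r
  step = ≤-trans (+-monoˡ-≤ (x * r) (m≤n+m r k)) (≤-reflexive (sym (*-suc x r)))

-- Losing a fraction 1/(x+1) at most (x+1)/2 times leaves at least half. This serves three times:
-- for the blue weight, for the total vertex weight and for the greedy clique.
suc^≤2* : ∀ k x → 2 * k ≤ suc x → suc x ^ k ≤ 2 * x ^ k
suc^≤2* k x 2k≤1+x with m≤n⇒∃[o]m+o≡n (≤-trans (m≤m+n k _) 2k≤1+x)
... | r , eq′ = *-cancelʳ-≤ (suc x ^ k) (2 * x ^ k) r {{r≢0}} (begin
  suc x ^ k * r        ≤⟨ bernoulli-pred k r eq ⟩
  x ^ k * suc x        ≤⟨ *-monoʳ-≤ (x ^ k) 1+x≤2r ⟩
  x ^ k * (2 * r)      ≡⟨ rearrange (x ^ k) r ⟩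
  2 * x ^ k * r        ∎)
  where
  eq : suc x ≡ k + r
  eq = sym eq′
  rearrange : ∀ z r → z * (2 * r) ≡ 2 * z * r
  rearrange = solve-∀
  k≤r : k ≤ r
  k≤r = +-cancelˡ-≤ k k r (begin
    k + k    ≡⟨ cong (k +_) (+-identityʳ k) ⟨
    2 * k    ≤⟨ 2k≤1+x ⟩
    suc x    ≡⟨ eq ⟩
    k + r    ∎)
  1+x≤2r : suc x ≤ 2 * r
  1+x≤2r = begin
    suc x       ≡⟨ eq ⟩
    k + r       ≤⟨ +-monoˡ-≤ r k≤r ⟩
    r + r       ≡⟨ cong (r +_) (+-identityʳ r) ⟨
    2 * r       ∎
  r≢0 : NonZero r
  r≢0 = m*n≢0⇒n≢0 2 {{>-nonZero (≤-trans (s≤s z≤n) 1+x≤2r)}}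

-- Adds up inequalities between logarithms to base 2 in exponential form, so that no logarithm has
-- to be defined.
prod-^-mono : ∀ {n} e {a b g h : Fin n → _} →
              (∀ i → 2 ^ a i * g i ^ e ≤ 2 ^ b i * h i ^ e) →
              2 ^ sum a * prod g ^ e ≤ 2 ^ sum b * prod h ^ e
prod-^-mono {zero}  e le = ≤-refl
prod-^-mono {suc n} e {a} {b} {g} {h} le = begin
  2 ^ (a zero + sum (a ∘ suc)) * (g zero * prod (g ∘ suc)) ^ e             ≡⟨ regroup (a zero) (g zero) ⟩
  2 ^ a zero * g zero ^ e * (2 ^ sum (a ∘ suc) * prod (g ∘ suc) ^ e)       ≤⟨ *-mono-≤ (le zero) (prod-^-mono e (le ∘ suc)) ⟩
  2 ^ b zero * h zero ^ e * (2 ^ sum (b ∘ suc) * prod (h ∘ suc) ^ e)       ≡⟨ regroup (b zero) (h zero) ⟨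
  2 ^ (b zero + sum (b ∘ suc)) * (h zero * prod (h ∘ suc)) ^ e             ∎
  where
  regroup : ∀ x y {x′ y′} → 2 ^ (x + x′) * (y * y′) ^ e ≡ 2 ^ x * y ^ e * (2 ^ x′ * y′ ^ e)
  regroup x y {x′} {y′} = trans (cong₂ _*_ (^-distribˡ-+-* 2 x x′) (^-distribʳ-* e y y′))
    (*-interchange (2 ^ x) (2 ^ x′) (y ^ e) (y′ ^ e))

-- Sums over all vertex sets.

∑ˢ : ∀ {n} → (Subset n → ℕ) → ℕ
∑ˢ {zero}  f = f []
∑ˢ {suc n} f = ∑ˢ (f ∘ (outside ∷_)) + ∑ˢ (f ∘ (inside ∷_))

∑ˢ-mono : ∀ {n} {f g : Subset n → ℕ} → (∀ S → f S ≤ g S) → ∑ˢ f ≤ ∑ˢ g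
∑ˢ-mono {zero}  f≤g = f≤g []
∑ˢ-mono {suc n} f≤g = +-mono-≤ (∑ˢ-mono (f≤g ∘ (outside ∷_))) (∑ˢ-mono (f≤g ∘ (inside ∷_)))

∑ˢ-cong : ∀ {n} {f g : Subset n → ℕ} → (∀ S → f S ≡ g S) → ∑ˢ f ≡ ∑ˢ g
∑ˢ-cong {zero}  f≗g = f≗g []
∑ˢ-cong {suc n} f≗g = cong₂ _+_ (∑ˢ-cong (f≗g ∘ (outside ∷_))) (∑ˢ-cong (f≗g ∘ (inside ∷_)))

∑ˢ-distrib-+ : ∀ {n} (f g : Subset n → ℕ) → ∑ˢ (λ S → f S + g S) ≡ ∑ˢ f + ∑ˢ g
∑ˢ-distrib-+ {zero}  f g = refl
∑ˢ-distrib-+ {suc n} f g = trans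
  (cong₂ _+_ (∑ˢ-distrib-+ (f ∘ (outside ∷_)) (g ∘ (outside ∷_)))
             (∑ˢ-distrib-+ (f ∘ (inside ∷_)) (g ∘ (inside ∷_))))
  (+-interchange (∑ˢ (f ∘ (outside ∷_))) _ _ _)

*-distribˡ-∑ˢ : ∀ {n} a (f : Subset n → ℕ) → a * ∑ˢ f ≡ ∑ˢ (λ S → a * f S)
*-distribˡ-∑ˢ {zero}  a f = refl
*-distribˡ-∑ˢ {suc n} a f = trans (*-distribˡ-+ a (∑ˢ (f ∘ (outside ∷_))) _)
  (cong₂ _+_ (*-distribˡ-∑ˢ a (f ∘ (outside ∷_))) (*-distribˡ-∑ˢ a (f ∘ (inside ∷_))))

term≤∑ˢ : ∀ {n} (f : Subset n → ℕ) S → f S ≤ ∑ˢ f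
term≤∑ˢ f []            = ≤-refl
term≤∑ˢ f (outside ∷ S) = ≤-trans (term≤∑ˢ (f ∘ (outside ∷_)) S) (m≤m+n _ _)
term≤∑ˢ f (inside ∷ S)  = ≤-trans (term≤∑ˢ (f ∘ (inside ∷_)) S) (m≤n+m _ _)

-- Binomial theorem: each vertex contributes `m` if left out and 1 if taken, hence a factor `suc m`.
∑ˢ-^∣∁∣ : ∀ n m → ∑ˢ {n} (λ S → m ^ ∣ ∁ S ∣) ≡ suc m ^ n
∑ˢ-^∣∁∣ zero    m = refl
∑ˢ-^∣∁∣ (suc n) m = begin-equality
  ∑ˢ {n} (λ S → m * m ^ ∣ ∁ S ∣) + A  ≡⟨ cong (_+ A) (*-distribˡ-∑ˢ {n} m (λ S → m ^ ∣ ∁ S ∣)) ⟨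
  m * A + A                        ≡⟨ +-comm (m * A) A ⟩
  suc m * A                        ≡⟨ cong (suc m *_) (∑ˢ-^∣∁∣ n m) ⟩
  suc m * suc m ^ n                ∎
  where
  A : ℕ
  A = ∑ˢ {n} (λ S → m ^ ∣ ∁ S ∣)

^-∣∣-∣∁∣ : ∀ {n} m (S : Subset n) → m ^ ∣ S ∣ * m ^ ∣ ∁ S ∣ ≡ m ^ n
^-∣∣-∣∁∣ m [] = refl
^-∣∣-∣∁∣ m (outside ∷ S) = trans (x∙yz≈y∙xz (m ^ ∣ S ∣) m _) (cong (m *_) (^-∣∣-∣∁∣ m S))
^-∣∣-∣∁∣ m (inside ∷ S)  = trans (*-assoc m (m ^ ∣ S ∣) _) (cong (m *_) (^-∣∣-∣∁∣ m S))

-- Single moves, the number of uncoloured entries, and the greedy choice of an edge.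

update-same : ∀ {n} (col : Colouring n) i j c → update col i j c i j ≡ c
update-same col i j c with i ≟ i | j ≟ j
... | yes _  | yes _  = refl
... | yes _  | no j≢j = contradiction refl j≢j
... | no i≢i | _      = contradiction refl i≢i

update-other : ∀ {n} (col : Colouring n) i j c {i′ j′} → ¬ (i′ ≡ i × j′ ≡ j) →
               update col i j c i′ j′ ≡ col i′ j′
update-other col i j c {i′} {j′} ne with i′ ≟ i | j′ ≟ j
... | yes i≡ | yes j≡ = contradiction (i≡ , j≡) ne
... | yes _  | no _   = refl
... | no _   | _      = refl

update-unc⁻ : ∀ {n} (col : Colouring n) i j c {i′ j′} → c ≢ unc →
              update col i j c i′ j′ ≡ unc → col i′ j′ ≡ unc
update-unc⁻ col i j c {i′} {j′} c≢unc e with i′ ≟ i | j′ ≟ j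
... | yes _ | yes _ = contradiction e c≢unc
... | yes _ | no _  = e
... | no _  | _     = e

_≟ᶜ_ : (c d : Colour) → Dec (c ≡ d)
unc  ≟ᶜ unc  = yes refl
unc  ≟ᶜ red  = no λ ()
unc  ≟ᶜ blue = no λ ()
red  ≟ᶜ unc  = no λ ()
red  ≟ᶜ red  = yes refl
red  ≟ᶜ blue = no λ ()
blue ≟ᶜ unc  = no λ ()
blue ≟ᶜ red  = no λ ()
blue ≟ᶜ blue = yes refl

-- A termination measure. Only its strict decrease under moves matters, so entries off the upper
-- triangle are counted too.
uncoloured : ∀ {n} → Colouring n → ℕ
uncoloured col = sum₂ λ i j → if ⌊ col i j ≟ᶜ unc ⌋ then 1 else 0

uncoloured-update : ∀ {n} (col : Colouring n) i j c → c ≢ unc → col i j ≡ unc →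
                    uncoloured (update col i j c) < uncoloured col
uncoloured-update col i j c c≢unc e =
  sum-mono-< i (λ i′ → sum-mono (λ j′ → shrinks i′ j′)) (sum-mono-< j (shrinks i) drops)
  where
  shrinks : ∀ i′ j′ → (if ⌊ update col i j c i′ j′ ≟ᶜ unc ⌋ then 1 else 0) ≤
                      (if ⌊ col i′ j′ ≟ᶜ unc ⌋ then 1 else 0)
  shrinks i′ j′ with update col i j c i′ j′ ≟ᶜ unc | col i′ j′ ≟ᶜ unc
  ... | yes e′ | no ne = contradiction (update-unc⁻ col i j c c≢unc e′) ne
  ... | yes _  | yes _ = ≤-refl
  ... | no _   | _     = z≤n
  drops : (if ⌊ update col i j c i j ≟ᶜ unc ⌋ then 1 else 0) <
          (if ⌊ col i j ≟ᶜ unc ⌋ then 1 else 0)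
  drops with update col i j c i j ≟ᶜ unc | col i j ≟ᶜ unc
  ... | yes e′ | _     = contradiction (trans (sym (update-same col i j c)) e′) c≢unc
  ... | no _   | yes _ = ≤-refl
  ... | no _   | no ne = contradiction e ne

-- Lists the free edges: an empty list means that the game is over, and otherwise an `argmax` over
-- the list is the greedy move.
full⊎maximal : ∀ {n} (col : Colouring n) (f : Fin n → Fin n → ℕ) →
  Full col ⊎ ∃₂ λ i j → i <ᶠ j × col i j ≡ unc ×
    (∀ k l → k <ᶠ l → col k l ≡ unc → f k l ≤ f i j)
full⊎maximal {n} col f = search (filter free? pairs) refl
  where
  Free : Fin n × Fin n → Set
  Free (i , j) = i <ᶠ j × col i j ≡ unc
  free? : ∀ e → Dec (Free e)
  free? (i , j) = (i <? j) ×-dec (col i j ≟ᶜ unc)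
  pairs : List (Fin n × Fin n)
  pairs = cartesianProduct (allFin n) (allFin n)
  ∈-free : ∀ {i j} → i <ᶠ j → col i j ≡ unc → (i , j) ∈ˡ filter free? pairs
  ∈-free i<j e = ∈-filter⁺ free? (∈-cartesianProduct⁺ (∈-allFin _) (∈-allFin _)) (i<j , e)
  search : ∀ es → filter free? pairs ≡ es →
    Full col ⊎ ∃₂ λ i j → i <ᶠ j × col i j ≡ unc ×
      (∀ k l → k <ᶠ l → col k l ≡ unc → f k l ≤ f i j)
  search []       eq = inj₁ λ i j i<j e → case subst ((i , j) ∈ˡ_) eq (∈-free i<j e) of λ ()
  search (e ∷ es) eq = inj₂ (proj₁ m , proj₂ m , proj₁ m-free , proj₂ m-free , λ k l k<l e′ →
    All.lookup {P = λ x → uncurry f x ≤ uncurry f m} (f[xs]≤f[argmax] {f = uncurry f} e (e ∷ es))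
      (subst ((k , l) ∈ˡ_) eq (∈-free k<l e′)))
    where
    m : Fin n × Fin n
    m = argmax (uncurry f) e (e ∷ es)
    all-free : All Free (e ∷ es)
    all-free = subst (All Free) eq (all-filter free? pairs)
    m-free : Free m
    m-free = argmax-all (uncurry f) (All.head all-free) all-free

-- Edges inside a vertex set.

joins : ∀ {n} → Subset n → Fin n → Fin n → Bool
joins S i j = lookup S i ∧ lookup S j ∧ ⌊ i <? j ⌋

edge : ∀ {n} → Colouring n → Colour → Subset n → Fin n → Fin n → ℕ
edge col c S i j = if joins S i j ∧ ⌊ col i j ≟ᶜ c ⌋ then 1 else 0

edges : ∀ {n} → Colouring n → Colour → Subset n → ℕ
edges col c S = sum₂ (edge col c S)

-- The potential and its change under a single move.

module Potential (p u : ℕ) .{{_ : NonZero p}} .{{_ : NonZero u}} where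

  -- All weights are scaled by β so as to be natural numbers; a pair not joined
  -- by S also contributes β, so that every S has the same number of factors.
  β : ℕ
  β = 4 * p * u

  instance
    β≢0 : NonZero β
    β≢0 = m*n≢0 (4 * p) u {{m*n≢0 4 p}}

  -- Divided by `β` the weights are 1, 1 + 1/(2p) and 1 - 1/β, since 2u/β = 1/(2p).
  ω : Colour → ℕ
  ω unc  = β
  ω red  = β + 2 * u
  ω blue = pred β

  entry : Bool → Colour → ℕ
  entry b c = if b then ω c else β

  entry-unc : ∀ b → entry b unc ≡ β
  entry-unc true  = refl
  entry-unc false = refl

  -- The exponent 2pu is β/2. By Bernoulli (1 + 1/(2p))^(2p) is at least 2, and the `u`-th power of
  -- this is the claim.
  red-gain : 2 ^ u * β ^ (2 * p * u) ≤ ω red ^ (2 * p * u)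
  red-gain = begin
    2 ^ u * β ^ (2 * p * u)      ≡⟨ cong (2 ^ u *_) (^-*-assoc β (2 * p) u) ⟨
    2 ^ u * (β ^ (2 * p)) ^ u    ≡⟨ ^-distribʳ-* u 2 (β ^ (2 * p)) ⟨
    (2 * β ^ (2 * p)) ^ u        ≤⟨ ^-monoˡ-≤ u double ⟩
    (ω red ^ (2 * p)) ^ u        ≡⟨ ^-*-assoc (ω red) (2 * p) u ⟩
    ω red ^ (2 * p * u)          ∎
    where
    β+β : ∀ p u → 4 * p * u + 2 * p * (2 * u) ≡ 4 * p * u * 2
    β+β = solve-∀
    double : 2 * β ^ (2 * p) ≤ ω red ^ (2 * p)
    double = *-cancelˡ-≤ β (begin
      β * (2 * β ^ (2 * p))                        ≡⟨ *-assoc β 2 _ ⟨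
      β * 2 * β ^ (2 * p)                          ≡⟨ *-comm (β * 2) _ ⟩
      β ^ (2 * p) * (β * 2)                        ≡⟨ cong (β ^ (2 * p) *_) (β+β p u) ⟨
      β ^ (2 * p) * (β + 2 * p * (2 * u))          ≤⟨ bernoulli-+ (2 * p) β (2 * u) ⟩
      β * ω red ^ (2 * p)                          ∎)

  blue-loss : β ^ (2 * p * u) ≤ 2 * ω blue ^ (2 * p * u)
  blue-loss = subst (λ x → x ^ (2 * p * u) ≤ 2 * pred β ^ (2 * p * u)) (suc-pred β)
    (suc^≤2* (2 * p * u) (pred β) (≤-reflexive (trans (β-half p u) (sym (suc-pred β)))))
    where
    β-half : ∀ p u → 2 * (2 * p * u) ≡ 4 * p * u
    β-half = solve-∀

  module _ {n : ℕ} where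

    -- Stands for (2n)^(-∣S∣), up to the constant (2n)^n.
    vertexWeight : Subset n → ℕ
    vertexWeight S = (2 * n) ^ ∣ ∁ S ∣

    edgeWeight : Colouring n → Subset n → ℕ
    edgeWeight col S = prod₂ λ i j → entry (joins S i j) (col i j)

    weight : Colouring n → Subset n → ℕ
    weight col S = vertexWeight S * edgeWeight col S

    Φ : Colouring n → ℕ
    Φ col = ∑ˢ (weight col)

    weightAt : Colouring n → Fin n → Fin n → Subset n → ℕ
    weightAt col i j S = if joins S i j then weight col S else 0

    -- The part of `Φ` carried by the sets containing both ends: for an uncoloured edge, the slope
    -- of `Φ` in the relative weight of that edge.
    danger : Colouring n → Fin n → Fin n → ℕ
    danger col i j = ∑ˢ (weightAt col i j)

    danger≤Φ : ∀ col i j → danger col i j ≤ Φ col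
    danger≤Φ col i j = ∑ˢ-mono λ S → lemma (joins S i j) (weight col S)
      where
      lemma : ∀ b w → (if b then w else 0) ≤ w
      lemma true  w = ≤-refl
      lemma false w = z≤n

    -- An uncoloured entry contributes the factor `β`, so multiplying by `β` on the left stands for
    -- dividing by the factor that is replaced.
    weight-update : ∀ col i j c S → col i j ≡ unc →
                    β * weight (update col i j c) S ≡
                    entry (joins S i j) c * weight col S
    weight-update col i j c S e = begin-equality
      β * (v * edgeWeight (update col i j c) S)  ≡⟨ x∙yz≈y∙xz β v _ ⟩
      v * (β * edgeWeight (update col i j c) S)  ≡⟨ cong (v *_) (prod₂-factor i j β x off at) ⟩
      v * (x * edgeWeight col S)                 ≡⟨ x∙yz≈y∙xz v x _ ⟩
      x * (v * edgeWeight col S)                 ∎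
      where
      v = vertexWeight S
      x = entry (joins S i j) c
      off : ∀ i′ j′ → ¬ (i′ ≡ i × j′ ≡ j) →
            entry (joins S i′ j′) (update col i j c i′ j′) ≡ entry (joins S i′ j′) (col i′ j′)
      off i′ j′ ne = cong (entry (joins S i′ j′)) (update-other col i j c ne)
      at : β * entry (joins S i j) (update col i j c i j) ≡ x * entry (joins S i j) (col i j)
      at = trans (*-comm β _) (cong₂ _*_ (cong (entry (joins S i j)) (update-same col i j c))
             (sym (trans (cong (entry (joins S i j)) e) (entry-unc (joins S i j)))))

    -- `Φ` is affine in the weight of each single edge, so the change is exact, with no higher-order
    -- term. The same holds for a blue move.
    Φ-red : ∀ col i j → col i j ≡ unc →
            β * Φ (update col i j red) ≡ β * Φ col + 2 * u * danger col i j
    Φ-red col i j e = begin-equality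
      β * Φ col′                                            ≡⟨ *-distribˡ-∑ˢ β (weight col′) ⟩
      ∑ˢ (λ S → β * weight col′ S)                          ≡⟨ ∑ˢ-cong (λ S → trans (weight-update col i j red S e) (split (joins S i j) (weight col S))) ⟩
      ∑ˢ (λ S → β * weight col S + 2 * u * weightAt col i j S)
                                                             ≡⟨ ∑ˢ-distrib-+ (λ S → β * weight col S) (λ S → 2 * u * weightAt col i j S) ⟩
      ∑ˢ (λ S → β * weight col S) + ∑ˢ (λ S → 2 * u * weightAt col i j S)
                                                             ≡⟨ cong₂ _+_ (*-distribˡ-∑ˢ β (weight col)) (*-distribˡ-∑ˢ (2 * u) (weightAt col i j)) ⟨
      β * Φ col + 2 * u * danger col i j                    ∎
      where
      col′ = update col i j red
      split : ∀ b w → entry b red * w ≡ β * w + 2 * u * (if b then w else 0)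
      split true  w = *-distribʳ-+ w β (2 * u)
      split false w = sym (trans (cong (β * w +_) (*-zeroʳ (2 * u))) (+-identityʳ (β * w)))

    Φ-blue : ∀ col i j → col i j ≡ unc →
             β * Φ (update col i j blue) + danger col i j ≡ β * Φ col
    Φ-blue col i j e = begin-equality
      β * Φ col′ + danger col i j                           ≡⟨ cong (_+ danger col i j) (*-distribˡ-∑ˢ β (weight col′)) ⟩
      ∑ˢ (λ S → β * weight col′ S) + danger col i j         ≡⟨ ∑ˢ-distrib-+ (λ S → β * weight col′ S) (weightAt col i j) ⟨
      ∑ˢ (λ S → β * weight col′ S + weightAt col i j S)     ≡⟨ ∑ˢ-cong (λ S → trans (cong (_+ weightAt col i j S) (weight-update col i j blue S e)) (join (joins S i j) (weight col S))) ⟩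
      ∑ˢ (λ S → β * weight col S)                           ≡⟨ *-distribˡ-∑ˢ β (weight col) ⟨
      β * Φ col                                             ∎
      where
      col′ = update col i j blue
      join : ∀ b w → entry b blue * w + (if b then w else 0) ≡ β * w
      join true  w = trans (+-comm (pred β * w) w) (cong (_* w) (suc-pred β))
      join false w = +-identityʳ (β * w)

    -- The comparison is made set by set. Sets joining `i` and `j` have their weight multiplied by
    -- `ω c` over `β`, the others keep theirs; the two hypotheses on `a` and `b` handle these two
    -- cases.
    danger-update : ∀ a b col i j c → col i j ≡ unc →
                    a * ω c ≤ b * β → a ≤ b → ∀ k l →
                    a * danger (update col i j c) k l ≤ b * danger col k l
    danger-update a b col i j c e aω≤bβ a≤b k l = begin
      a * danger col′ k l                ≡⟨ *-distribˡ-∑ˢ a (weightAt col′ k l) ⟩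
      ∑ˢ (λ S → a * weightAt col′ k l S)  ≤⟨ ∑ˢ-mono (λ S → restrict (joins S k l) (weight≤ S)) ⟩
      ∑ˢ (λ S → b * weightAt col k l S)   ≡⟨ *-distribˡ-∑ˢ b (weightAt col k l) ⟨
      b * danger col k l                 ∎
      where
      col′ = update col i j c
      restrict : ∀ x {v w} → a * v ≤ b * w →
                 a * (if x then v else 0) ≤ b * (if x then w else 0)
      restrict true  le = le
      restrict false le = ≤-trans (≤-reflexive (*-zeroʳ a)) z≤n
      entry≤ : ∀ x → a * entry x c ≤ b * β
      entry≤ true  = aω≤bβ
      entry≤ false = *-monoˡ-≤ β a≤b
      weight≤ : ∀ S → a * weight col′ S ≤ b * weight col S
      weight≤ S = *-cancelˡ-≤ β (begin
        β * (a * weight col′ S)           ≡⟨ x∙yz≈y∙xz β a _ ⟩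
        a * (β * weight col′ S)                        ≡⟨ cong (a *_) (weight-update col i j c S e) ⟩
        a * (entry (joins S i j) c * weight col S)      ≡⟨ *-assoc a (entry (joins S i j) c) _ ⟨
        a * entry (joins S i j) c * weight col S        ≤⟨ *-monoˡ-≤ (weight col S) (entry≤ (joins S i j)) ⟩
        b * β * weight col S                            ≡⟨ *-assoc b β _ ⟩
        b * (β * weight col S)                          ≡⟨ x∙yz≈y∙xz b β _ ⟩
        β * (b * weight col S)                          ∎)

    -- From a bounded potential to few red edges in every vertex set.

    Φ-empty : Φ empty ≡ suc (2 * n) ^ n * prod₂ {n} (λ _ _ → β)
    Φ-empty = begin-equality
      Φ empty                             ≡⟨ ∑ˢ-cong (λ S → trans (*-comm (vertexWeight S) _) (cong (_* vertexWeight S) (blank S))) ⟩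
      ∑ˢ (λ S → P * vertexWeight S)       ≡⟨ *-distribˡ-∑ˢ P vertexWeight ⟨
      P * ∑ˢ vertexWeight                 ≡⟨ cong (P *_) (∑ˢ-^∣∁∣ n (2 * n)) ⟩
      P * suc (2 * n) ^ n                 ≡⟨ *-comm P _ ⟩
      suc (2 * n) ^ n * P                 ∎
      where
      P = prod₂ {n} (λ _ _ → β)
      blank : ∀ S → edgeWeight empty S ≡ P
      blank S = prod-cong λ i → prod-cong λ j → entry-unc (joins S i j)

    -- Raised to the power β/2 and relative to `β`, a red edge counts at least 2^u, a blue edge at
    -- least 1/2, and any other entry exactly 1. The 1/2 appears as a factor 2 on the right.
    edge-bound : ∀ b c → 2 ^ (u * (if b ∧ ⌊ c ≟ᶜ red ⌋ then 1 else 0)) * β ^ (2 * p * u) ≤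
                         2 ^ (if b ∧ ⌊ c ≟ᶜ blue ⌋ then 1 else 0) * entry b c ^ (2 * p * u)
    edge-bound true red  = subst₂ (λ x y → 2 ^ x * β ^ (2 * p * u) ≤ y)
      (sym (*-identityʳ u)) (sym (*-identityˡ _)) red-gain
    edge-bound true blue = subst (λ x → 2 ^ x * β ^ (2 * p * u) ≤ 2 * ω blue ^ (2 * p * u))
      (sym (*-zeroʳ u)) (≤-trans (≤-reflexive (*-identityˡ _)) blue-loss)
    edge-bound true unc  = ≤-reflexive (cong (λ x → 2 ^ x * β ^ (2 * p * u)) (*-zeroʳ u))
    edge-bound false c   = ≤-reflexive (cong (λ x → 2 ^ x * β ^ (2 * p * u)) (*-zeroʳ u))

    -- One term is at most the whole sum, and (1 + 1/(2n))^n ≤ 2, so the edge weight exceeds its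
    -- initial value by a factor of at most 4·(2n)^∣S∣. Here `ℓ` bounds log₂(2n), and the extra unit
    -- in `suc ∣ S ∣` absorbs the 4.
    edgeWeight≤ : ∀ ℓ col S .{{_ : NonZero n}} → 2 * n ≤ 2 ^ ℓ → 4 ≤ 2 ^ ℓ →
                  Φ col ≤ 2 * Φ empty →
                  edgeWeight col S ≤ 2 ^ (ℓ * suc ∣ S ∣) * prod₂ {n} (λ _ _ → β)
    edgeWeight≤ ℓ col S 2n≤ 4≤ Φ≤ = *-cancelˡ-≤ (m ^ n) {{m^n≢0 m n}} (begin
      m ^ n * W                                  ≡⟨ cong (_* W) (^-∣∣-∣∁∣ m S) ⟨
      m ^ s * m ^ ∣ ∁ S ∣ * W                    ≡⟨ *-assoc (m ^ s) _ W ⟩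
      m ^ s * weight col S                       ≤⟨ *-monoʳ-≤ (m ^ s) (term≤∑ˢ (weight col) S) ⟩
      m ^ s * Φ col                              ≤⟨ *-monoʳ-≤ (m ^ s) Φ≤ ⟩
      m ^ s * (2 * Φ empty)                      ≡⟨ cong (λ x → m ^ s * (2 * x)) Φ-empty ⟩
      m ^ s * (2 * (suc m ^ n * P))              ≤⟨ *-monoʳ-≤ (m ^ s) (*-monoʳ-≤ 2 (*-monoˡ-≤ P (suc^≤2* n m (n≤1+n m)))) ⟩
      m ^ s * (2 * (2 * m ^ n * P))              ≡⟨ collect (m ^ s) (m ^ n) P ⟩
      m ^ n * (4 * m ^ s * P)                    ≤⟨ *-monoʳ-≤ (m ^ n) (*-monoˡ-≤ P (*-mono-≤ 4≤ (^-monoˡ-≤ s 2n≤))) ⟩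
      m ^ n * ((2 ^ ℓ) ^ suc s * P)              ≡⟨ cong (λ x → m ^ n * (x * P)) (^-*-assoc 2 ℓ (suc s)) ⟩
      m ^ n * (2 ^ (ℓ * suc s) * P)              ∎)
      where
      m = 2 * n
      s = ∣ S ∣
      W = edgeWeight col S
      P = prod₂ {n} (λ _ _ → β)
      instance
        m≢0 : NonZero m
        m≢0 = m*n≢0 2 n
      collect : ∀ x y z → x * (2 * (2 * y * z)) ≡ y * (4 * x * z)
      collect = solve-∀

    -- The product of `edge-bound` over all pairs bounds the power `E` = β/2 of the edge weight from
    -- below, and `edgeWeight≤` bounds it from above. Cancelling `P ^ E` leaves two powers of 2,
    -- whose exponents are compared.
    red-sparse : ∀ ℓ col S .{{_ : NonZero n}} → 2 * n ≤ 2 ^ ℓ → 4 ≤ 2 ^ ℓ →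
                 Φ col ≤ 2 * Φ empty →
                 u * edges col red S ≤ edges col blue S + ℓ * suc ∣ S ∣ * (2 * p * u)
    red-sparse ℓ col S 2n≤ 4≤ Φ≤ = ^-cancelˡ-≤ 2 ≤-refl (*-cancelʳ-≤ _ _ (P ^ E) (begin
      2 ^ (u * r) * P ^ E                                ≡⟨ cong (λ x → 2 ^ x * P ^ E) u*r ⟩
      2 ^ sum₂ (λ i j → u * edge col red S i j) * P ^ E  ≤⟨ prod-^-mono E (λ i → prod-^-mono E (λ j → edge-bound (joins S i j) (col i j))) ⟩
      2 ^ b * edgeWeight col S ^ E                       ≤⟨ *-monoʳ-≤ (2 ^ b) (^-monoˡ-≤ E (edgeWeight≤ ℓ col S 2n≤ 4≤ Φ≤)) ⟩
      2 ^ b * (2 ^ L * P) ^ E                            ≡⟨ cong (2 ^ b *_) (^-distribʳ-* E (2 ^ L) P) ⟩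
      2 ^ b * ((2 ^ L) ^ E * P ^ E)                      ≡⟨ *-assoc (2 ^ b) _ (P ^ E) ⟨
      2 ^ b * (2 ^ L) ^ E * P ^ E                        ≡⟨ cong (λ x → 2 ^ b * x * P ^ E) (^-*-assoc 2 L E) ⟩
      2 ^ b * 2 ^ (L * E) * P ^ E                        ≡⟨ cong (_* P ^ E) (^-distribˡ-+-* 2 b (L * E)) ⟨
      2 ^ (b + L * E) * P ^ E                            ∎))
      where
      r = edges col red S
      b = edges col blue S
      L = ℓ * suc ∣ S ∣
      E = 2 * p * u
      P = prod₂ {n} (λ _ _ → β)
      instance
        P^E≢0 : NonZero (P ^ E)
        P^E≢0 = m^n≢0 P E {{subst NonZero (sym (trans (prod-cong {n} λ _ → prod-const n β) (prod-const n (β ^ n))))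
                  (m^n≢0 (β ^ n) n {{m^n≢0 β n}})}}
      u*r : u * r ≡ sum₂ (λ i j → u * edge col red S i j)
      u*r = trans (*-distribˡ-sum u (λ i → sum (edge col red S i)))
                  (sum-cong-≗ λ i → *-distribˡ-sum u (edge col red S i))

    -- The greedy strategy keeps the potential bounded.

    module Strategy (q K : ℕ) (β≤q : β ≤ q)
      (outcome : ∀ col → Full col → Φ col ≤ K →
                 ∀ a b → CliqueNumber col red a → CliqueNumber col blue b → a < b) where

      -- In both turns m counts the moves already made and k those left. During
      -- Bob's turn the dangers stay at most d and each move gains at least d.
      -- During Alice's turn they grow to at most (1 + m/p)d ≤ 2d, so that each of
      -- her moves raises β Φ by at most 2u · 2d, and p · 4u · d = β d ≤ q d.
      Unc≤ : Colouring n → ℕ → ℕ → ℕ → Set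
      Unc≤ col a b d = ∀ i j → i <ᶠ j → col i j ≡ unc → a * danger col i j ≤ b * d

      Φ≤K : ∀ col x → β * Φ col + x ≤ β * K → Φ col ≤ K
      Φ≤K col x le = *-cancelˡ-≤ β (≤-trans (m≤m+n _ x) le)

      turnEnd : ℕ → ℕ
      turnEnd zero    = 1
      turnEnd (suc _) = 0

      turnEnd≤0 : ∀ {k} → 1 ≤ k → turnEnd k ≤ 0
      turnEnd≤0 (s≤s _) = z≤n

      -- A pass colours nothing but lowers `turnEnd`, as the next turn has at least one move. A move
      -- may raise `turnEnd` by one, which the weight 2 on uncoloured entries outweighs.
      fuel : ℕ → Colouring n → ℕ
      fuel k col = turnEnd k + 2 * uncoloured col

      fuel-move : ∀ k col i j c → c ≢ unc → col i j ≡ unc →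
                  fuel k (update col i j c) < 2 * uncoloured col
      fuel-move k col i j c c≢unc e = begin-strict
        turnEnd k + 2 * U′      ≤⟨ +-monoˡ-≤ (2 * U′) (turnEnd≤1 k) ⟩
        1 + 2 * U′              <⟨ ≤-refl ⟩
        2 + 2 * U′              ≡⟨ *-suc 2 U′ ⟨
        2 * suc U′              ≤⟨ *-monoʳ-≤ 2 (uncoloured-update col i j c c≢unc e) ⟩
        2 * uncoloured col      ∎
        where
        U′ = uncoloured (update col i j c)
        turnEnd≤1 : ∀ k → turnEnd k ≤ 1
        turnEnd≤1 zero    = ≤-refl
        turnEnd≤1 (suc _) = z≤n

      mutual

        bobTurn : ∀ f k m d col → fuel k col < f → k + m ≡ q →
                  β * Φ col + m * d ≤ β * K → Unc≤ col 1 1 d →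
                  BobWins p q bob k col
        bobTurn (suc f) k m d col (s≤s fl) k+m≡q Φ≤ D≤ with full⊎maximal col (danger col)
        bobTurn (suc f) k m d col (s≤s fl) k+m≡q Φ≤ D≤ | inj₁ full =
          over full (outcome col full (Φ≤K col (m * d) Φ≤))
        bobTurn (suc f) zero m d col (s≤s fl) refl Φ≤ D≤ | inj₂ (i , j , i<j , e , _) =
          passB (λ full → full i j i<j e)
            (aliceTurn f p 0 d col (≤-trans (s≤s (+-monoˡ-≤ _ (turnEnd≤0 (>-nonZero⁻¹ p)))) fl) (+-identityʳ p)
              (≤-trans (+-monoʳ-≤ _ (*-monoˡ-≤ d (≤-trans (≤-reflexive (budget p u)) β≤q))) Φ≤)
              λ k l k<l e′ → subst (λ x → p * danger col k l ≤ x * d) (sym (+-identityʳ p))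
                (*-monoʳ-≤ p (*-cancelˡ-≤ 1 (D≤ k l k<l e′))))
          where
          budget : ∀ p u → p * (4 * u) ≡ 4 * p * u
          budget = solve-∀
        bobTurn (suc f) (suc k) m d col (s≤s fl) k+m≡q Φ≤ D≤ | inj₂ (i , j , i<j , e , max) =
          bobMove i j i<j e
            -- The new bound is the danger of the edge taken, which is maximal. It is at most the
            -- old `d`, so the `m` earlier gains are still at least as large.
            (bobTurn f k (suc m) (danger col i j) col′ (≤-trans (fuel-move k col i j blue (λ ()) e) fl)
              (trans (+-suc k m) k+m≡q)
              (begin
                β * Φ col′ + (D + m * D)  ≡⟨ +-assoc (β * Φ col′) D _ ⟨
                β * Φ col′ + D + m * D    ≡⟨ cong (_+ m * D) (Φ-blue col i j e) ⟩
                β * Φ col + m * D         ≤⟨ +-monoʳ-≤ (β * Φ col) (*-monoʳ-≤ m (subst₂ _≤_ (*-identityˡ D) (*-identityˡ d) (D≤ i j i<j e))) ⟩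
                β * Φ col + m * d         ≤⟨ Φ≤ ⟩
                β * K                     ∎)
              λ k l k<l e′ → ≤-trans
                (danger-update 1 1 col i j blue e (*-monoʳ-≤ 1 pred[n]≤n) ≤-refl k l)
                (*-monoʳ-≤ 1 (max k l k<l (update-unc⁻ col i j blue (λ ()) e′))))
          where
          col′ = update col i j blue
          D = danger col i j

        aliceTurn : ∀ f k m d col → fuel k col < f → k + m ≡ p →
                    β * Φ col + k * (4 * u) * d ≤ β * K → Unc≤ col p (p + m) d →
                    BobWins p q alice k col
        aliceTurn (suc f) k m d col (s≤s fl) k+m≡p Φ≤ D≤ with full⊎maximal col (danger col)
        aliceTurn (suc f) k m d col (s≤s fl) k+m≡p Φ≤ D≤ | inj₁ full =
          over full (outcome col full (Φ≤K col _ Φ≤))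
        aliceTurn (suc f) zero m d col (s≤s fl) k+m≡p Φ≤ D≤ | inj₂ (i , j , i<j , e , _) =
          passA (λ full → full i j i<j e)
            -- Before the first blue move of the turn any bound on the dangers will do, because it
            -- enters the budget with factor 0; `Φ col` is such a bound.
            (bobTurn f q 0 (Φ col) col (≤-trans (s≤s (+-monoˡ-≤ _ (turnEnd≤0 (≤-trans (>-nonZero⁻¹ β) β≤q)))) fl) (+-identityʳ q) Φ≤
              λ k l _ _ → *-monoʳ-≤ 1 (danger≤Φ col k l))
        aliceTurn (suc f) (suc k) m d col (s≤s fl) k+m≡p Φ≤ D≤ | inj₂ (i₀ , j₀ , i₀<j₀ , e₀ , _) =
          aliceMove (λ full → full i₀ j₀ i₀<j₀ e₀) λ i j i<j e →
            aliceTurn f k (suc m) d (update col i j red) (≤-trans (fuel-move k col i j red (λ ()) e) fl)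
              (trans (+-suc k m) k+m≡p)
              (begin
                β * Φ (update col i j red) + k * (4 * u) * d              ≡⟨ cong (_+ k * (4 * u) * d) (Φ-red col i j e) ⟩
                β * Φ col + 2 * u * danger col i j + k * (4 * u) * d      ≤⟨ +-monoˡ-≤ (k * (4 * u) * d) (+-monoʳ-≤ (β * Φ col) (*-monoʳ-≤ (2 * u) (danger≤2d i j i<j e))) ⟩
                β * Φ col + 2 * u * (2 * d) + k * (4 * u) * d             ≡⟨ collect (β * Φ col) u d k ⟩
                β * Φ col + suc k * (4 * u) * d                           ≤⟨ Φ≤ ⟩
                β * K                                                     ∎)
              λ k l k<l e′ → *-cancelˡ-≤ (2 * p) {{m*n≢0 2 p}} (begin
                2 * p * (p * danger (update col i j red) k l)             ≡⟨ x∙yz≈y∙xz (2 * p) p _ ⟩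
                p * (2 * p * danger (update col i j red) k l)             ≤⟨ *-monoʳ-≤ p (danger-update (2 * p) (1 + 2 * p) col i j red e (≤-reflexive (ratio p u)) (n≤1+n _) k l) ⟩
                p * ((1 + 2 * p) * danger col k l)                        ≡⟨ x∙yz≈y∙xz p (1 + 2 * p) _ ⟩
                (1 + 2 * p) * (p * danger col k l)                        ≤⟨ *-monoʳ-≤ (1 + 2 * p) (D≤ k l k<l (update-unc⁻ col i j red (λ ()) e′)) ⟩
                (1 + 2 * p) * ((p + m) * d)                               ≡⟨ *-assoc (1 + 2 * p) (p + m) d ⟨
                (1 + 2 * p) * (p + m) * d                                 ≤⟨ *-monoˡ-≤ d growth ⟩
                2 * p * (p + suc m) * d                                   ≡⟨ *-assoc (2 * p) (p + suc m) d ⟩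
                2 * p * ((p + suc m) * d)                                 ∎)
          where
          m≤p : m ≤ p
          m≤p = ≤-trans (m≤n+m m (suc k)) (≤-reflexive k+m≡p)
          danger≤2d : ∀ i j → i <ᶠ j → col i j ≡ unc → danger col i j ≤ 2 * d
          danger≤2d i j i<j e = *-cancelˡ-≤ p (begin
            p * danger col i j  ≤⟨ D≤ i j i<j e ⟩
            (p + m) * d         ≤⟨ *-monoˡ-≤ d (+-monoʳ-≤ p m≤p) ⟩
            (p + p) * d         ≡⟨ double p d ⟩
            p * (2 * d)         ∎)
            where
            double : ∀ p d → (p + p) * d ≡ p * (2 * d)
            double = solve-∀
          collect : ∀ x u d k → x + 2 * u * (2 * d) + k * (4 * u) * d ≡ x + suc k * (4 * u) * d
          collect = solve-∀
          ratio : ∀ p u → 2 * p * (4 * p * u + 2 * u) ≡ (1 + 2 * p) * (4 * p * u)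
          ratio = solve-∀
          -- This is (1 + 1/(2p))(1 + m/p) ≤ 1 + (m + 1)/p, which holds because 1 + m/p ≤ 2.
          growth : (1 + 2 * p) * (p + m) ≤ 2 * p * (p + suc m)
          growth = begin
            (1 + 2 * p) * (p + m)          ≡⟨ expand p m ⟩
            2 * p * (p + m) + (p + m)      ≤⟨ +-monoʳ-≤ (2 * p * (p + m)) (+-monoʳ-≤ p m≤p) ⟩
            2 * p * (p + m) + (p + p)      ≡⟨ contract p m ⟩
            2 * p * (p + suc m)            ∎
            where
            expand : ∀ p m → (1 + 2 * p) * (p + m) ≡ 2 * p * (p + m) + (p + m)
            expand = solve-∀
            contract : ∀ p m → 2 * p * (p + m) + (p + p) ≡ 2 * p * (p + suc m)
            contract = solve-∀

      -- Alice's first turn is not prepaid by blue moves. With d = `Φ empty` it costs at most p·4u·d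
      -- = β·`Φ empty`, hence the factor 2.
      bob-wins : 2 * Φ empty ≤ K → Player2Wins p q n
      bob-wins 2Φ≤K = aliceTurn _ p 0 (Φ empty) empty ≤-refl (+-identityʳ p)
        (≤-trans (≤-reflexive (double p u (Φ empty))) (*-monoʳ-≤ β 2Φ≤K))
        λ i j _ _ → *-mono-≤ (m≤m+n p 0) (danger≤Φ empty i j)
        where
        double : ∀ p u x → 4 * p * u * x + p * (4 * u) * x ≡ 4 * p * u * (2 * x)
        double = solve-∀

-- Averaging, degrees and neighbourhoods.

χ : ∀ {n} → Subset n → Fin n → ℕ
χ S i = if lookup S i then 1 else 0

∣∣≡sum-χ : ∀ {n} (S : Subset n) → ∣ S ∣ ≡ sum (χ S)
∣∣≡sum-χ []            = refl
∣∣≡sum-χ (outside ∷ S) = ∣∣≡sum-χ S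
∣∣≡sum-χ (inside ∷ S)  = cong suc (∣∣≡sum-χ S)

sum-point : ∀ {n} (v : Fin n) → sum (λ u → if does (u ≟ v) then 1 else 0) ≡ 1
sum-point {suc n} zero    = cong suc (sum-replicate-zero n)
sum-point {suc n} (suc v) = sum-point v

∣∪⁅⁆∣ : ∀ {n} (S : Subset n) v → v ∉ S → ∣ S ∪ ⁅ v ⁆ ∣ ≡ suc ∣ S ∣
∣∪⁅⁆∣ (inside ∷ S)  zero    v∉S = contradiction here v∉S
∣∪⁅⁆∣ (outside ∷ S) zero    v∉S = cong (suc ∘ ∣_∣) (∪-identityʳ S)
∣∪⁅⁆∣ (inside ∷ S)  (suc v) v∉S = cong suc (∣∪⁅⁆∣ S v (v∉S ∘ there))
∣∪⁅⁆∣ (outside ∷ S) (suc v) v∉S = ∣∪⁅⁆∣ S v (v∉S ∘ there)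

-- If every vertex of `S` failed, summing over `S` would give ∣S∣·(1 + sum f) ≤ ∣S∣·sum f; terms
-- outside `S` only enlarge the right side.
∃-below-average : ∀ {n} (S : Subset n) (f : Fin n → ℕ) → 1 ≤ ∣ S ∣ →
                  ∃ λ v → v ∈ S × ∣ S ∣ * f v ≤ sum f
∃-below-average S f 1≤s with any? (λ v → (v ∈? S) ×-dec (∣ S ∣ * f v ≤? sum f))
... | yes below = below
... | no none   = contradiction (*-cancelˡ-≤ ∣ S ∣ {{>-nonZero 1≤s}} (begin
  ∣ S ∣ * suc (sum f)                ≡⟨ cong (_* suc (sum f)) (∣∣≡sum-χ S) ⟩
  sum (χ S) * suc (sum f)            ≡⟨ *-distribʳ-sum (suc (sum f)) (χ S) ⟩
  sum (λ v → χ S v * suc (sum f))    ≤⟨ sum-mono above ⟩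
  sum (λ v → ∣ S ∣ * f v)            ≡⟨ *-distribˡ-sum ∣ S ∣ f ⟨
  ∣ S ∣ * sum f                      ∎)) 1+n≰n
  where
  above : ∀ v → χ S v * suc (sum f) ≤ ∣ S ∣ * f v
  above v with lookup S v in eq
  ... | true  = ≤-trans (≤-reflexive (*-identityˡ _)) (≰⇒> λ le → none (v , lookup⇒[]= v S eq , le))
  ... | false = z≤n

module _ {n : ℕ} (col : Colouring n) where

  edge-elim : ∀ c S i j → 1 ≤ edge col c S i j → i ∈ S × j ∈ S × i <ᶠ j × col i j ≡ c
  edge-elim c S i j le with lookup S i in i∈ | lookup S j in j∈ | i <? j | col i j ≟ᶜ c
  ... | true | true | yes i<j | yes eq = lookup⇒[]= i S i∈ , lookup⇒[]= j S j∈ , i<j , eq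

  edge-clique : ∀ {c d} S → c ≢ d → IsClique col c S → ∀ i j → edge col d S i j ≡ 0
  edge-clique {c} {d} S c≢d clique i j with 1 ≤? edge col d S i j
  ... | no ≱1 = n<1⇒n≡0 (≰⇒> ≱1)
  ... | yes ≥1 with i∈S , j∈S , i<j , eq ← edge-elim d S i j ≥1 =
    contradiction (trans (sym (clique i j i∈S j∈S i<j)) eq) c≢d

  -- Edges are stored with increasing ends, so both orders are added; at most one summand is
  -- nonzero.
  adjacent : Colour → Subset n → Fin n → Fin n → ℕ
  adjacent c S v u = edge col c S u v + edge col c S v u

  degree : Colour → Subset n → Fin n → ℕ
  degree c S v = sum (adjacent c S v)

  -- Handshake lemma: one half of the degree sum becomes the other by exchanging the order of
  -- summation.
  sum-degree : ∀ c S → sum (degree c S) ≡ 2 * edges col c S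
  sum-degree c S = begin-equality
    sum (degree c S)                                                     ≡⟨ sum-cong-≗ (λ v → ∑-distrib-+ (λ u → edge col c S u v) (edge col c S v)) ⟩
    sum (λ v → sum (λ u → edge col c S u v) + sum (edge col c S v))      ≡⟨ ∑-distrib-+ (λ v → sum (λ u → edge col c S u v)) (λ v → sum (edge col c S v)) ⟩
    sum (λ v → sum (λ u → edge col c S u v)) + edges col c S             ≡⟨ cong (_+ edges col c S) (∑-comm (λ v u → edge col c S u v)) ⟩
    edges col c S + edges col c S                                        ≡⟨ cong (edges col c S +_) (+-identityʳ (edges col c S)) ⟨
    2 * edges col c S                                                    ∎

  adjacent≤ : ∀ c S v u → adjacent c S v u ≤ χ S v * χ S u
  adjacent≤ c S v u with lookup S u | lookup S v | u <? v | v <? u | col u v ≟ᶜ c | col v u ≟ᶜ c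
  ... | true  | true  | yes u<v | yes v<u | _     | _     = contradiction v<u (<⇒≯ u<v)
  ... | true  | true  | yes _   | no _    | yes _ | _     = ≤-refl
  ... | true  | true  | yes _   | no _    | no _  | _     = z≤n
  ... | true  | true  | no _    | yes _   | _     | yes _ = ≤-refl
  ... | true  | true  | no _    | yes _   | _     | no _  = z≤n
  ... | true  | true  | no _    | no _    | _     | _     = z≤n
  ... | true  | false | _       | _       | _     | _     = z≤n
  ... | false | true  | _       | _       | _     | _     = z≤n
  ... | false | false | _       | _       | _     | _     = z≤n

  2*edges≤ : ∀ c S → 2 * edges col c S ≤ ∣ S ∣ * ∣ S ∣
  2*edges≤ c S = begin
    2 * edges col c S                         ≡⟨ sum-degree c S ⟨
    sum (degree c S)                          ≤⟨ sum-mono (λ v → sum-mono (adjacent≤ c S v)) ⟩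
    sum (λ v → sum (λ u → χ S v * χ S u))     ≡⟨ sum-cong-≗ (λ v → *-distribˡ-sum (χ S v) (χ S)) ⟨
    sum (λ v → χ S v * sum (χ S))             ≡⟨ *-distribʳ-sum (sum (χ S)) (χ S) ⟨
    sum (χ S) * sum (χ S)                     ≡⟨ cong₂ _*_ (∣∣≡sum-χ S) (∣∣≡sum-χ S) ⟨
    ∣ S ∣ * ∣ S ∣                             ∎

  -- Every vertex of `S` other than `v` is a red or a blue neighbour of `v`; the 1 is `v` itself.
  ∣∣≤degrees : Full col → ∀ S v → v ∈ S → ∣ S ∣ ≤ 1 + degree red S v + degree blue S v
  ∣∣≤degrees full S v v∈S = begin
    ∣ S ∣                                                ≡⟨ ∣∣≡sum-χ S ⟩
    sum (χ S)                                            ≤⟨ sum-mono cover ⟩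
    sum (λ u → point u + adjacent red S v u + adjacent blue S v u)
                                                         ≡⟨ ∑-distrib-+ (λ u → point u + adjacent red S v u) (adjacent blue S v) ⟩
    sum (λ u → point u + adjacent red S v u) + degree blue S v
                                                         ≡⟨ cong (_+ degree blue S v) (∑-distrib-+ point (adjacent red S v)) ⟩
    sum point + degree red S v + degree blue S v         ≡⟨ cong (λ x → x + degree red S v + degree blue S v) (sum-point v) ⟩
    1 + degree red S v + degree blue S v                 ∎
    where
    point : Fin n → ℕ
    point u = if does (u ≟ v) then 1 else 0
    cover : ∀ u → χ S u ≤ point u + adjacent red S v u + adjacent blue S v u
    cover u with lookup S u | lookup S v | []=⇒lookup v∈S | u ≟ v | u <? v | v <? u | full u v | full v u
    ... | false | _ | _ | _ | _ | _ | _ | _ = z≤n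
    ... | true | true | _ | yes _ | _ | _ | _ | _ = s≤s z≤n
    ... | true | true | _ | no u≢v | no u≮v | no v≮u | _ | _ = contradiction (Finₚ.≤-antisym (≮⇒≥ v≮u) (≮⇒≥ u≮v)) u≢v
    ... | true | true | _ | no _ | yes u<v | _ | uv | _ with col u v
    ...   | unc  = contradiction refl (uv u<v)
    ...   | red  = s≤s z≤n
    ...   | blue = ≤-trans (s≤s z≤n) (m≤n+m _ _)
    cover u | true | true | _ | no _ | no _ | yes v<u | _ | vu with col v u
    ...   | unc  = contradiction refl (vu v<u)
    ...   | red  = s≤s z≤n
    ...   | blue = ≤-refl

  adjacent≤1 : ∀ c S v u → adjacent c S v u ≤ 1
  adjacent≤1 c S v u = ≤-trans (adjacent≤ c S v u) (*-mono-≤ (χ≤1 v) (χ≤1 u))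
    where
    χ≤1 : ∀ i → χ S i ≤ 1
    χ≤1 i with lookup S i
    ... | true  = ≤-refl
    ... | false = z≤n

  adjacent-elim : ∀ c S v u → 1 ≤ adjacent c S v u →
                  u ∈ S × (u <ᶠ v × col u v ≡ c ⊎ v <ᶠ u × col v u ≡ c)
  adjacent-elim c S v u le with 1 ≤? edge col c S u v
  ... | yes ≥1 with u∈S , _ , u<v , eq ← edge-elim c S u v ≥1 = u∈S , inj₁ (u<v , eq)
  ... | no ≱1 with _ , u∈S , v<u , eq ← edge-elim c S v u
                     (subst (λ x → 1 ≤ x + edge col c S v u) (n<1⇒n≡0 (≰⇒> ≱1)) le) = u∈S , inj₂ (v<u , eq)

  neighbours : Colour → Subset n → Fin n → Subset n
  neighbours c S v = tabulate λ u → ⌊ 1 ≤? adjacent c S v u ⌋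

  ∈-neighbours : ∀ c S v u → u ∈ neighbours c S v → 1 ≤ adjacent c S v u
  ∈-neighbours c S v u u∈ with 1 ≤? adjacent c S v u | trans (sym (lookup∘tabulate (λ u → ⌊ 1 ≤? adjacent c S v u ⌋) u)) ([]=⇒lookup u∈)
  ... | yes ≥1 | _ = ≥1

  degree≤∣neighbours∣ : ∀ c S v → degree c S v ≤ ∣ neighbours c S v ∣
  degree≤∣neighbours∣ c S v = ≤-trans (sum-mono adjacent≤χ) (≤-reflexive (sym (∣∣≡sum-χ (neighbours c S v))))
    where
    adjacent≤χ : ∀ u → adjacent c S v u ≤ χ (neighbours c S v) u
    adjacent≤χ u rewrite lookup∘tabulate (λ u → ⌊ 1 ≤? adjacent c S v u ⌋) u
      with 1 ≤? adjacent c S v u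
    ... | yes _  = adjacent≤1 c S v u
    ... | no ≱1 = ≤-reflexive (n<1⇒n≡0 (≰⇒> ≱1))

  clique-extend : ∀ c S v T → T ⊆ neighbours c S v → IsClique col c T →
                  IsClique col c (T ∪ ⁅ v ⁆)
  clique-extend c S v T T⊆ clique i j i∈ j∈ i<j with x∈p∪q⁻ T ⁅ v ⁆ i∈ | x∈p∪q⁻ T ⁅ v ⁆ j∈
  ... | inj₁ i∈T | inj₁ j∈T = clique i j i∈T j∈T i<j
  ... | inj₂ i∈v | inj₂ j∈v = contradiction i<j (Finₚ.<-irrefl (trans (x∈⁅y⁆⇒x≡y v i∈v) (sym (x∈⁅y⁆⇒x≡y v j∈v))))
  ... | inj₁ i∈T | inj₂ j∈v rewrite x∈⁅y⁆⇒x≡y v j∈v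
    with adjacent-elim c S v i (∈-neighbours c S v i (T⊆ i∈T))
  ...   | _ , inj₁ (_ , eq)  = eq
  ...   | _ , inj₂ (v<i , _) = contradiction v<i (<⇒≯ i<j)
  clique-extend c S v T T⊆ clique i j i∈ j∈ i<j | inj₂ i∈v | inj₁ j∈T rewrite x∈⁅y⁆⇒x≡y v i∈v
    with adjacent-elim c S v j (∈-neighbours c S v j (T⊆ j∈T))
  ...   | _ , inj₁ (j<v , _) = contradiction j<v (<⇒≯ i<j)
  ...   | _ , inj₂ (_ , eq)  = eq

  ∉-neighbours : ∀ c S v → v ∉ neighbours c S v
  ∉-neighbours c S v v∈ with adjacent-elim c S v v (∈-neighbours c S v v v∈)
  ... | _ , inj₁ (v<v , _) = 1+n≰n v<v
  ... | _ , inj₂ (v<v , _) = 1+n≰n v<v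

  -- Clique sizes when every vertex set has few red edges.

  module Sparse (u e : ℕ) .{{_ : NonZero u}}
    (sparse : ∀ S → u * edges col red S ≤ edges col blue S + u * e * suc ∣ S ∣) where

    -- A vertex of at most average red degree, combined with `sparse`; the error term is simplified
    -- by 1 + ∣S∣ ≤ 2∣S∣.
    ∃-low-degree : ∀ S → 1 ≤ ∣ S ∣ →
      ∃ λ v → v ∈ S × ∣ S ∣ * (u * degree red S v) ≤ 2 * edges col blue S + ∣ S ∣ * (u * (4 * e))
    ∃-low-degree S 1≤s with ∃-below-average S (λ v → u * degree red S v) 1≤s
    ... | v , v∈S , le = v , v∈S , (begin
      ∣ S ∣ * (u * degree red S v)                        ≤⟨ le ⟩
      sum (λ v → u * degree red S v)                      ≡⟨ *-distribˡ-sum u (degree red S) ⟨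
      u * sum (degree red S)                              ≡⟨ cong (u *_) (sum-degree red S) ⟩
      u * (2 * edges col red S)                           ≡⟨ x∙yz≈y∙xz u 2 _ ⟩
      2 * (u * edges col red S)                           ≤⟨ *-monoʳ-≤ 2 (sparse S) ⟩
      2 * (b + u * e * suc ∣ S ∣)                         ≤⟨ *-monoʳ-≤ 2 (+-monoʳ-≤ b (*-monoʳ-≤ (u * e) (+-monoˡ-≤ ∣ S ∣ 1≤s))) ⟩
      2 * (b + u * e * (∣ S ∣ + ∣ S ∣))                   ≡⟨ collect b u e ∣ S ∣ ⟩
      2 * b + ∣ S ∣ * (u * (4 * e))                       ∎)
      where
      b = edges col blue S
      collect : ∀ b u e s → 2 * (b + u * e * (s + s)) ≡ 2 * b + s * (u * (4 * e))
      collect = solve-∀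

    -- Without blue edges inside `S`, `∃-low-degree` yields a vertex of red degree at most 4e, yet
    -- in a red clique all other vertices are its red neighbours.
    red-clique≤ : Full col → ∀ S → IsClique col red S → ∣ S ∣ ≤ 1 + 4 * e
    red-clique≤ full S clique with 1 ≤? ∣ S ∣
    ... | no ≱1 = ≤-trans (≤-reflexive (n<1⇒n≡0 (≰⇒> ≱1))) z≤n
    ... | yes 1≤s with ∃-low-degree S 1≤s
    ...   | v , v∈S , le = begin
      ∣ S ∣                                       ≤⟨ ∣∣≤degrees full S v v∈S ⟩
      1 + degree red S v + degree blue S v        ≡⟨ cong (1 + degree red S v +_) no-blue-degree ⟩
      1 + degree red S v + 0                      ≡⟨ +-identityʳ _ ⟩
      1 + degree red S v                          ≤⟨ s≤s (*-cancelˡ-≤ u (*-cancelˡ-≤ ∣ S ∣ {{>-nonZero 1≤s}}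
                                                       (subst (λ b → ∣ S ∣ * (u * degree red S v) ≤ 2 * b + ∣ S ∣ * (u * (4 * e))) no-blue le))) ⟩
      1 + 4 * e                                   ∎
      where
      sum-zero : ∀ {f : Fin n → ℕ} → (∀ i → f i ≡ 0) → sum f ≡ 0
      sum-zero f≗0 = trans (sum-cong-≗ f≗0) (sum-replicate-zero n)
      no-edge : ∀ i j → edge col blue S i j ≡ 0
      no-edge = edge-clique S (λ ()) clique
      no-blue : edges col blue S ≡ 0
      no-blue = sum-zero λ i → sum-zero (no-edge i)
      no-blue-degree : degree blue S v ≡ 0
      no-blue-degree = sum-zero λ j → cong₂ _+_ (no-edge j v) (no-edge v j)

    -- With Q = `suc D`, the size condition says that `S` can lose a fraction 1/Q `k` times and keep
    -- `s₀` vertices. Above `s₀` the error term is harmless, so passing to the blue neighbourhood of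
    -- a vertex of low red degree loses no more than that fraction.
    blue-clique : Full col → ∀ D s₀ → 4 * suc D ≤ u → 2 * suc D ≤ s₀ → u * (4 * e) ≤ s₀ →
                  ∀ k S → s₀ * suc D ^ k ≤ ∣ S ∣ * D ^ k →
                  ∃ λ T → T ⊆ S × ∣ T ∣ ≡ k × IsClique col blue T
    blue-clique full D s₀ 4Q≤u 2Q≤s₀ ue≤s₀ zero S _ =
      ⊥ , (λ x∈⊥ → contradiction x∈⊥ ∉⊥) , ∣⊥∣≡0 n , λ i j i∈⊥ _ _ → contradiction i∈⊥ ∉⊥
    blue-clique full D s₀ 4Q≤u 2Q≤s₀ ue≤s₀ (suc k) S large = step (∃-low-degree S 1≤s)
      where
      Q s : ℕ
      Q = suc D
      s = ∣ S ∣
      s₀≤s : s₀ ≤ s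
      s₀≤s = *-cancelʳ-≤ s₀ s (Q ^ suc k) {{m^n≢0 Q (suc k)}}
        (≤-trans large (*-monoʳ-≤ s (^-monoˡ-≤ (suc k) (n≤1+n D))))
      1≤s : 1 ≤ s
      1≤s = ≤-trans (≤-trans (s≤s z≤n) 2Q≤s₀) s₀≤s
      step : (∃ λ v → v ∈ S × s * (u * degree red S v) ≤ 2 * edges col blue S + s * (u * (4 * e))) →
             ∃ λ T → T ⊆ S × ∣ T ∣ ≡ suc k × IsClique col blue T
      step (v , v∈S , le) with blue-clique full D s₀ 4Q≤u 2Q≤s₀ ue≤s₀ k S′ large′
        where
        S′ = neighbours blue S v
        d = degree red S v
        ud≤2s : u * d ≤ 2 * s
        ud≤2s = *-cancelˡ-≤ s {{>-nonZero 1≤s}} (begin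
          s * (u * d)                                      ≤⟨ le ⟩
          2 * edges col blue S + s * (u * (4 * e))         ≤⟨ +-mono-≤ (2*edges≤ blue S) (*-monoʳ-≤ s (≤-trans ue≤s₀ s₀≤s)) ⟩
          s * s + s * s                                    ≡⟨ double s ⟩
          s * (2 * s)                                      ∎)
          where
          double : ∀ s → s * s + s * s ≡ s * (2 * s)
          double = solve-∀
        -- The vertex `v` and its `d` red neighbours each use half of the allowed loss: 2Q ≤ s for
        -- `v`, and 4Q·d ≤ u·d ≤ 2s for the neighbours.
        Q[1+d]≤s : Q * (1 + d) ≤ s
        Q[1+d]≤s = *-cancelˡ-≤ 4 (begin
          4 * (Q * (1 + d))              ≡⟨ expand Q d ⟩
          2 * (2 * Q) + 4 * Q * d        ≤⟨ +-mono-≤ (*-monoʳ-≤ 2 (≤-trans 2Q≤s₀ s₀≤s)) (≤-trans (*-monoˡ-≤ d 4Q≤u) ud≤2s) ⟩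
          2 * s + 2 * s                  ≡⟨ double s ⟩
          4 * s                          ∎)
          where
          expand : ∀ Q d → 4 * (Q * (1 + d)) ≡ 2 * (2 * Q) + 4 * Q * d
          expand = solve-∀
          double : ∀ s → 2 * s + 2 * s ≡ 4 * s
          double = solve-∀
        Ds≤Qs′ : D * s ≤ Q * ∣ S′ ∣
        Ds≤Qs′ = +-cancelˡ-≤ s (D * s) (Q * ∣ S′ ∣) (begin
          Q * s                                  ≤⟨ *-monoʳ-≤ Q (≤-trans (∣∣≤degrees full S v v∈S) (+-monoʳ-≤ (1 + d) (degree≤∣neighbours∣ blue S v))) ⟩
          Q * (1 + d + ∣ S′ ∣)                   ≡⟨ *-distribˡ-+ Q (1 + d) ∣ S′ ∣ ⟩
          Q * (1 + d) + Q * ∣ S′ ∣               ≤⟨ +-monoˡ-≤ (Q * ∣ S′ ∣) Q[1+d]≤s ⟩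
          s + Q * ∣ S′ ∣                         ∎)
        large′ : s₀ * Q ^ k ≤ ∣ S′ ∣ * D ^ k
        large′ = *-cancelˡ-≤ Q (begin
          Q * (s₀ * Q ^ k)          ≡⟨ x∙yz≈y∙xz Q s₀ _ ⟩
          s₀ * (Q * Q ^ k)          ≤⟨ large ⟩
          s * (D * D ^ k)           ≡⟨ x∙yz≈yx∙z s D _ ⟩
          D * s * D ^ k             ≤⟨ *-monoˡ-≤ (D ^ k) Ds≤Qs′ ⟩
          Q * ∣ S′ ∣ * D ^ k        ≡⟨ *-assoc Q ∣ S′ ∣ (D ^ k) ⟩
          Q * (∣ S′ ∣ * D ^ k)      ∎)
      ... | T , T⊆ , ∣T∣≡k , clique =
        T ∪ ⁅ v ⁆ , ⊆S , trans (∣∪⁅⁆∣ T v (∉-neighbours blue S v ∘ T⊆)) (cong suc ∣T∣≡k) ,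
        clique-extend blue S v T T⊆ clique
        where
        ⊆S : T ∪ ⁅ v ⁆ ⊆ S
        ⊆S {x} x∈ with x∈p∪q⁻ T ⁅ v ⁆ x∈
        ... | inj₁ x∈T = proj₁ (adjacent-elim blue S v x (∈-neighbours blue S v x (T⊆ x∈T)))
        ... | inj₂ x∈v = subst (_∈ S) (sym (x∈⁅y⁆⇒x≡y v x∈v)) v∈S

-- Choice of the constants and conclusion.

n<2^n : ∀ n → n < 2 ^ n
n<2^n zero    = ≤-refl
n<2^n (suc n) = begin-strict
  suc n              ≤⟨ n<2^n n ⟩
  2 ^ n              <⟨ m<m+n (2 ^ n) (m^n>0 2 n) ⟩
  2 ^ n + 2 ^ n      ≡⟨ cong (2 ^ n +_) (+-identityʳ (2 ^ n)) ⟨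
  2 * 2 ^ n          ∎

-- An integer substitute for the logarithm to base 8: the exponent is raised only when the argument
-- outgrows the current power.
∃-power-of-8 : ∀ x → ∃ λ h → suc x ≤ 8 ^ h × 8 ^ h ≤ 8 * suc x
∃-power-of-8 zero = 0 , ≤-refl , s≤s z≤n
∃-power-of-8 (suc x) with ∃-power-of-8 x
... | h , x≤ , ≤8x with suc (suc x) ≤? 8 ^ h
...   | yes le = h , le , ≤-trans ≤8x (*-monoʳ-≤ 8 (n≤1+n (suc x)))
...   | no ≰ = suc h , le , *-monoʳ-≤ 8 (≤-trans (≮⇒≥ ≰) (n≤1+n (suc x)))
  where
  le : suc (suc x) ≤ 8 * 8 ^ h
  le = begin
    suc (suc x)        ≤⟨ s≤s (m≤n+m (suc x) x) ⟩
    suc x + suc x      ≤⟨ +-mono-≤ x≤ x≤ ⟩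
    8 ^ h + 8 ^ h      ≤⟨ +-monoʳ-≤ (8 ^ h) (m≤m+n (8 ^ h) _) ⟩
    8 * 8 ^ h          ∎

-- Here log₂ n is about 3h; the threshold s₀ · 2^h ≤ n leaves room for 25ph steps of
-- the greedy argument, which together cost a factor 2^h.
module Outcome (p n h : ℕ) .{{_ : NonZero p}} .{{_ : NonZero n}}
  (h-large : 76800 * (p * p) ≤ h) (2n≤8^h : 2 * n ≤ 8 ^ h) (8^h≤16n : 8 ^ h ≤ 8 * (2 * n)) where

  -- `u` is four times the 50p of the loss fraction 1/(50p). With ℓ = 3h the error coefficient
  -- 3h·2p·u equals u·e, and `s₀` = u·4e is the size from which this error is harmless.
  u e s₀ : ℕ
  u  = 200 * p
  e  = 6 * (p * h)
  s₀ = 4800 * (p * p) * h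

  instance
    u≢0 : NonZero u
    u≢0 = m*n≢0 200 p
    pp≢0 : NonZero (p * p)
    pp≢0 = m*n≢0 p p

  open Potential p u

  8^h≡ : 2 ^ (3 * h) ≡ 8 ^ h
  8^h≡ = sym (^-*-assoc 2 3 h)

  76800≤h : 76800 ≤ h
  76800≤h = ≤-trans (m≤m*n 76800 (p * p)) h-large

  -- `8 ^ h` is a product of three factors `2 ^ h`: the first dominates 76800p², where 76800 =
  -- 16·4800, the second dominates `h`, and the third is the factor in the claim.
  s₀2^h≤n : s₀ * 2 ^ h ≤ n
  s₀2^h≤n = *-cancelˡ-≤ 16 (begin
    16 * (s₀ * 2 ^ h)                        ≡⟨ regroup (p * p) h (2 ^ h) ⟩
    76800 * (p * p) * h * 2 ^ h              ≤⟨ *-monoˡ-≤ (2 ^ h) (*-mono-≤ (≤-trans h-large (<⇒≤ (n<2^n h))) (<⇒≤ (n<2^n h))) ⟩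
    2 ^ h * 2 ^ h * 2 ^ h                    ≡⟨ cong (_* 2 ^ h) (^-distribʳ-* h 2 2) ⟨
    4 ^ h * 2 ^ h                            ≡⟨ ^-distribʳ-* h 4 2 ⟨
    8 ^ h                                    ≤⟨ 8^h≤16n ⟩
    8 * (2 * n)                              ≡⟨ *-assoc 8 2 n ⟨
    16 * n                                   ∎)
    where
    regroup : ∀ x h y → 16 * (4800 * x * h * y) ≡ 76800 * x * h * y
    regroup = solve-∀

  -- Red cliques have at most 1 + 24ph vertices, while the greedy argument builds a blue clique on
  -- 25ph vertices.
  blue-exceeds-red : ∀ (col : Colouring n) → Full col → Φ col ≤ 2 * Φ {n} empty →
                     ∀ a b → CliqueNumber col red a → CliqueNumber col blue b → a < b
  blue-exceeds-red col full Φ≤ a b ((A , ∣A∣≡a , A-red) , _) (_ , blue≤b) = begin-strict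
    a                              ≡⟨ ∣A∣≡a ⟨
    ∣ A ∣                          ≤⟨ red-clique≤ full A A-red ⟩
    1 + 4 * e                      <⟨ gap ⟩
    25 * p * h                     ≡⟨ ∣T∣≡k ⟨
    ∣ T ∣                          ≤⟨ blue≤b T T-blue ⟩
    b                              ∎
    where
    D : ℕ
    D = pred (50 * p)
    Q≡ : suc D ≡ 50 * p
    Q≡ = suc-pred (50 * p) {{m*n≢0 50 p}}
    sparse : ∀ S → u * edges col red S ≤ edges col blue S + u * e * suc ∣ S ∣
    sparse S = ≤-trans
      (red-sparse (3 * h) col S (≤-trans 2n≤8^h (≤-reflexive (sym 8^h≡)))
        (^-monoʳ-≤ 2 {2} (≤-trans (≤-trans (m≤m+n 2 76798) 76800≤h) (m≤m+n h _))) Φ≤)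
      (≤-reflexive (cong (edges col blue S +_) (regroup h (suc ∣ S ∣) p u)))
      where
      regroup : ∀ h s p u → 3 * h * s * (2 * p * u) ≡ u * (6 * (p * h)) * s
      regroup = solve-∀
    open Sparse col u e sparse
    gap : 1 + 4 * e < 25 * p * h
    gap = begin
      2 + 4 * e                ≤⟨ +-monoˡ-≤ (4 * e) (≤-trans (≤-trans (m≤m+n 2 76798) 76800≤h) (m≤n*m h p)) ⟩
      p * h + 4 * e            ≡⟨ regroup p h ⟩
      25 * p * h               ∎
      where
      regroup : ∀ p h → p * h + 4 * (6 * (p * h)) ≡ 25 * p * h
      regroup = solve-∀
    4Q≤u : 4 * suc D ≤ u
    4Q≤u = ≤-reflexive (trans (cong (4 *_) Q≡) (sym (*-assoc 4 50 p)))
    2Q≤s₀ : 2 * suc D ≤ s₀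
    2Q≤s₀ = begin
      2 * suc D                      ≡⟨ cong (2 *_) Q≡ ⟩
      2 * (50 * p)                   ≡⟨ *-assoc 2 50 p ⟨
      100 * p                        ≤⟨ *-mono-≤ (m≤m+n 100 4700) (m≤m*n p p) ⟩
      4800 * (p * p)                 ≤⟨ m≤m*n (4800 * (p * p)) h {{>-nonZero (≤-trans (m≤m+n 1 76799) 76800≤h)}} ⟩
      s₀                             ∎
    u4e≤s₀ : u * (4 * e) ≤ s₀
    u4e≤s₀ = ≤-reflexive (regroup p h)
      where
      regroup : ∀ p h → 200 * p * (4 * (6 * (p * h))) ≡ 4800 * (p * p) * h
      regroup = solve-∀
    -- By `suc^≤2*`, 25p losses of a fraction 1/(50p) at most halve the set; this is repeated `h`
    -- times.
    large : s₀ * suc D ^ (25 * p * h) ≤ ∣ ⊤ {n} ∣ * D ^ (25 * p * h)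
    large = begin
      s₀ * suc D ^ (25 * p * h)                  ≡⟨ cong (s₀ *_) (^-*-assoc (suc D) (25 * p) h) ⟨
      s₀ * (suc D ^ (25 * p)) ^ h                ≤⟨ *-monoʳ-≤ s₀ (^-monoˡ-≤ h (suc^≤2* (25 * p) D (≤-reflexive (trans (sym (*-assoc 2 25 p)) (sym Q≡))))) ⟩
      s₀ * (2 * D ^ (25 * p)) ^ h                ≡⟨ cong (s₀ *_) (^-distribʳ-* h 2 _) ⟩
      s₀ * (2 ^ h * (D ^ (25 * p)) ^ h)          ≡⟨ *-assoc s₀ (2 ^ h) _ ⟨
      s₀ * 2 ^ h * (D ^ (25 * p)) ^ h            ≤⟨ *-monoˡ-≤ _ s₀2^h≤n ⟩
      n * (D ^ (25 * p)) ^ h                     ≡⟨ cong₂ _*_ (∣⊤∣≡n n) (sym (^-*-assoc D (25 * p) h)) ⟨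
      ∣ ⊤ {n} ∣ * D ^ (25 * p * h)               ∎
    clique = blue-clique full D s₀ 4Q≤u 2Q≤s₀ u4e≤s₀ (25 * p * h) ⊤ large
    T = proj₁ clique
    ∣T∣≡k = proj₁ (proj₂ (proj₂ clique))
    T-blue = proj₂ (proj₂ (proj₂ clique))

theorem3p4 : ∃ λ (c : ℕ) → ∀ (p q : ℕ) → 1 ≤ p → p < q → c * (p * p) < q →
    ∃ λ (N : ℕ) → ∀ (n : ℕ) → N ≤ n → Player2Wins p q n
-- The constant comes from `β` = 4p·200p = 800p², and the bound on `n` forces h ≥ 76800p².
theorem3p4 = 800 , λ p q 1≤p _ cp²<q → 8 ^ (76800 * (p * p)) , λ n N≤n →
  win p q n (∃-power-of-8 (pred (2 * n))) {{>-nonZero 1≤p}} {{>-nonZero (≤-trans (m^n>0 8 (76800 * (p * p))) N≤n)}} cp²<q N≤n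
  where
  win : ∀ p q n → (∃ λ h → suc (pred (2 * n)) ≤ 8 ^ h × 8 ^ h ≤ 8 * suc (pred (2 * n))) →
        .{{_ : NonZero p}} → .{{_ : NonZero n}} →
        800 * (p * p) < q → 8 ^ (76800 * (p * p)) ≤ n → Player2Wins p q n
  win p q n (h , lower , upper) cp²<q N≤n =
    Strategy.bob-wins {n} q (2 * Φ {n} empty) β≤q blue-exceeds-red ≤-refl
    where
    2n≡ : suc (pred (2 * n)) ≡ 2 * n
    2n≡ = suc-pred (2 * n) {{m*n≢0 2 n}}
    2n≤8^h : 2 * n ≤ 8 ^ h
    2n≤8^h = subst (_≤ 8 ^ h) 2n≡ lower
    h-large : 76800 * (p * p) ≤ h
    h-large = ^-cancelˡ-≤ 8 (m≤m+n 2 6) (≤-trans N≤n (≤-trans (m≤m+n n _) 2n≤8^h))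
    open Outcome p n h h-large 2n≤8^h (subst (λ x → 8 ^ h ≤ 8 * x) 2n≡ upper)
    open Potential p (200 * p)
    β≤q : 4 * p * (200 * p) ≤ q
    β≤q = ≤-trans (≤-reflexive (regroup p)) (<⇒≤ cp²<q)
      where
      regroup : ∀ p → 4 * p * (200 * p) ≡ 800 * (p * p)
      regroup = solve-∀
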